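{- Let $\mathbf S$ be a flip-swap language of binary strings of length $n$. When $\mathbf S$ is listed in BRGC order, the resulting listing is a $2$-Gray code. If $\mathbf S$ includes $0^n$, then the listing is cyclic.
   Context: A flip-swap language (with respect to $1$) is a set $\mathbf S$ of binary strings of length $n$ such that $\mathbf S\cup\{0^n\}$ is closed under the following two operations, whenever applicable: (1) flip (complement) the leftmost $1$; (2) swap the leftmost $1$ with the bit immediately to its right (applicable when the leftmost $1$ exists and is not in the last position). BRGC order on binary strings of length $n$ is the order of the listing $BRGC(n)$ defined recursively by $BRGC(1)=0,1$ and, for $n>1$, $BRGC(n)=BRGC(n-1)\cdot 0,\ \overline{BRGC}(n-1)\cdot 1$, where $\overline{BRGC}(m)$ is the listing $BRGC(m)$ in reverse order and $\mathcal L\cdot x$ is the listing $\mathcal L$ with the character $x$ appended to the end of each string. Listing $\mathbf S$ in BRGC order means listing its elements in the relative order in which they appear in $BRGC(n)$. A listing is a $2$-Gray code if consecutive strings differ in at most two bit positions; it is cyclic if the last and first strings also differ in at most two bit positions. -}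

module Defs where

open import Data.Bool.Base using (Bool; true; false; _xor_)
open import Data.List.Base as List using (List; []; _∷_; _++_; map; reverse; filter)
open import Data.List.Relation.Unary.Linked using (Linked)
open import Data.Maybe.Relation.Binary.Connected using (Connected)
open import Data.Nat.Base using (ℕ; zero; suc; _≤_; NonZero)
open import Data.Vec.Base as Vec using (Vec; []; _∷_; _∷ʳ_; replicate; zipWith; countᵇ)
open import Function.Base using (id)
open import Relation.Unary using (Pred; Decidable; _∈_; _∪_; ｛_｝)

-- The head of the vector is the leftmost bit; true is 1 and false is 0.
BitString : ℕ → Set
BitString n = Vec Bool n

zeros : ∀ n → BitString n
zeros n = replicate n false

-- FlipFirst x y: x contains a 1, and y is x with its leftmost 1 complemented.
data FlipFirst : ∀ {n} → BitString n → BitString n → Set where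
  here  : ∀ {n} {x : BitString n} → FlipFirst (true ∷ x) (false ∷ x)
  there : ∀ {n} {x y : BitString n} →
          FlipFirst x y → FlipFirst (false ∷ x) (false ∷ y)

-- SwapFirst x y: x has a leftmost 1 that is not its last bit, and y is x with
-- that 1 and the bit b to its right exchanged (so y is x when b is 1).
data SwapFirst : ∀ {n} → BitString n → BitString n → Set where
  here  : ∀ {n b} {x : BitString n} → SwapFirst (true ∷ b ∷ x) (b ∷ true ∷ x)
  there : ∀ {n} {x y : BitString n} →
          SwapFirst x y → SwapFirst (false ∷ x) (false ∷ y)

record FlipSwapLanguage {ℓ n} (S : Pred (BitString n) ℓ) : Set ℓ where
  field
    flip-closed : ∀ {x y} → x ∈ S ∪ ｛ zeros n ｝ → FlipFirst x y →
                  y ∈ S ∪ ｛ zeros n ｝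
    swap-closed : ∀ {x y} → x ∈ S ∪ ｛ zeros n ｝ → SwapFirst x y →
                  y ∈ S ∪ ｛ zeros n ｝

BRGC : ∀ n → .{{NonZero n}} → List (BitString n)
BRGC (suc zero)      = (false ∷ []) ∷ (true ∷ []) ∷ []
BRGC (suc (suc n)) =
  map (_∷ʳ false) (BRGC (suc n)) ++ map (_∷ʳ true) (reverse (BRGC (suc n)))

inBRGCOrder : ∀ {ℓ n} .{{_ : NonZero n}} {S : Pred (BitString n) ℓ} →
              Decidable S → List (BitString n)
inBRGCOrder {n = n} S? = filter S? (BRGC n)

hamming : ∀ {n} → BitString n → BitString n → ℕ
hamming x y = countᵇ id (zipWith _xor_ x y)

DifferInAtMost : ∀ {n} → ℕ → BitString n → BitString n → Set
DifferInAtMost k x y = hamming x y ≤ k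

2-GrayCode : ∀ {n} → List (BitString n) → Set
2-GrayCode = Linked (DifferInAtMost 2)

-- For a nonempty listing, Connected relates its last string to its first one;
-- it holds trivially for the empty listing.
Cyclic : ∀ {n} → List (BitString n) → Set
Cyclic xs = Connected (DifferInAtMost 2) (List.last xs) (List.head xs)

{-# OPTIONS --safe #-}

-- Restricting a flip-swap language to the strings with a fixed last bit b and
-- deleting that bit leaves a predicate closed under both operations, so one can
-- induct along the recursion of the BRGC. Write z for the zero string and e for
-- 0⋯01. If the predicate is not empty, its listing starts with z (flip down to
-- z); if it contains a nonzero string, then also e (flip down to a single 1 and
-- swap it to the end), and e is the last string of the BRGC. So each half of the
-- listing ends in z or e, and since these differ in one bit, the two halves meet
-- with a change of at most two bits. If the language lacks z, adjoin it: this only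
-- adds a first string to the listing.
module Submission where

open import Defs
open import Data.Bool.Base using (true; false; _xor_)
open import Data.Bool.Properties using (xor-comm) renaming (_≟_ to _≟ᵇ_)
open import Data.List.Base
  using (List; []; _∷_; [_]; _++_; map; reverse; reverseAcc; filter; head; last)
  renaming (_∷ʳ_ to _∷ʳᴸ_)
open import Data.List.Properties
  using (filter-++; filter-accept; filter-reject; last-map; map-++; ++-assoc; unfold-reverse)
open import Data.List.Relation.Unary.All as All using (All; []; _∷_)
import Data.List.Relation.Unary.All.Properties as All
open import Data.List.Relation.Unary.Linked as Linked using (Linked; []; [-]; _∷_; _∷′_)
import Data.List.Relation.Unary.Linked.Properties as Linked
open import Data.Maybe.Base as Maybe using (Maybe; just; nothing)
open import Data.Maybe.Relation.Binary.Connected as Connected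
  using (Connected; just; just-nothing; nothing-just; nothing)
open import Data.Nat.Base using (ℕ; zero; suc; _≤_; z≤n; s≤s; NonZero)
open import Data.Nat.Properties using (≤-reflexive; m≤n⇒m≤1+n)
open import Data.Product.Base using (_×_; _,_; proj₁; proj₂; ∃-syntax)
open import Data.Sum.Base using (inj₁; inj₂; [_,_]′)
open import Data.Vec.Base using ([]; _∷_; _∷ʳ_; countᵇ)
open import Data.Vec.Properties using (zipWith-comm; ∷ʳ-injectiveˡ; ∷ʳ-injectiveʳ; ≡-dec)
open import Function.Base using (id; _∘_)
open import Level using (Level)
open import Relation.Binary.Core using (Rel)
open import Relation.Binary.Definitions using (Symmetric)
open import Relation.Binary.PropositionalEquality
  using (_≡_; _≢_; refl; sym; trans; cong; cong₂; subst; subst₂; module ≡-Reasoning)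
open import Relation.Nullary using (¬_; yes; no; does; contradiction)
open import Relation.Unary using (Pred; Decidable; _∈_; _∪_; ｛_｝)
open import Relation.Unary.Properties using (_∪?_)

private
  variable
    a ℓ ℓ₁ ℓ₂ : Level
    A B : Set a
    n : ℕ

-- Filtering and reversing lists.

filter-map : {P : Pred B ℓ} (P? : Decidable P) (f : A → B) (xs : List A) →
             filter P? (map f xs) ≡ map f (filter (P? ∘ f) xs)
filter-map P? f [] = refl
filter-map P? f (x ∷ xs) with ih ← filter-map P? f xs | does (P? (f x))
... | true  = cong (f x ∷_) ih
... | false = ih

-- `reverse` is `reverseAcc []`, so the induction needs an arbitrary accumulator; it is filtered as
-- well, since entries move into it one by one.
filter-reverseAcc : {P : Pred A ℓ} (P? : Decidable P) (ys xs : List A) →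
  filter P? (reverseAcc ys xs) ≡ reverseAcc (filter P? ys) (filter P? xs)
filter-reverseAcc P? ys [] = refl
filter-reverseAcc P? ys (x ∷ xs)
  with ih ← filter-reverseAcc P? (x ∷ ys) xs | does (P? x)
... | true  = ih
... | false = ih

-- For comparing a language with and without 0⋯0 on the nonzero strings, where alone the two
-- predicates agree.
filter-agree : {P : Pred A ℓ₁} {Q : Pred A ℓ₂} (P? : Decidable P) (Q? : Decidable Q) →
  ∀ {xs} → All (λ x → (P x → Q x) × (Q x → P x)) xs → filter P? xs ≡ filter Q? xs
filter-agree P? Q? [] = refl
filter-agree P? Q? {x ∷ xs} ((p⇒q , q⇒p) ∷ pqs) with ih ← filter-agree P? Q? pqs | P? x
... | yes px = trans (cong (x ∷_) ih) (sym (filter-accept Q? (p⇒q px)))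
... | no ¬px = trans ih (sym (filter-reject Q? (¬px ∘ q⇒p)))

last-∷ʳ : (xs : List A) (x : A) → last (xs ∷ʳᴸ x) ≡ just x
last-∷ʳ []           x = refl
last-∷ʳ (_ ∷ [])     x = refl
last-∷ʳ (_ ∷ y ∷ xs) x = last-∷ʳ (y ∷ xs) x

head-map : (f : A → B) (xs : List A) → head (map f xs) ≡ Maybe.map f (head xs)
head-map f []      = refl
head-map f (_ ∷ _) = refl

head-reverse : (xs : List A) → head (reverse xs) ≡ last xs
head-reverse []       = refl
head-reverse (x ∷ xs) = go x xs
  where
  go : ∀ {ys} x xs → head (reverseAcc ys (x ∷ xs)) ≡ last (x ∷ xs)
  go x []       = refl
  go x (y ∷ xs) = go y xs

-- Invariant of the reversal: the part already reversed is linked, and its head is related to the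
-- head of what remains. Each move turns one link around by symmetry.
linked-reverseAcc : {R : Rel A ℓ} → Symmetric R → ∀ {xs ys} → Linked R xs →
  Connected R (head xs) (head ys) → Linked R ys → Linked R (reverseAcc ys xs)
linked-reverseAcc R-sym {[]}     _   _  Rys = Rys
linked-reverseAcc R-sym {x ∷ xs} Rxs c  Rys =
  linked-reverseAcc R-sym (Linked.tail Rxs)
    (Connected.sym R-sym (Linked.head′ Rxs)) (c ∷′ Rys)

linked-reverse : {R : Rel A ℓ} → Symmetric R → ∀ {xs} →
                 Linked R xs → Linked R (reverse xs)
linked-reverse R-sym {[]}    _   = []
linked-reverse R-sym {_ ∷ _} Rxs = linked-reverseAcc R-sym Rxs just-nothing []

-- Hamming distance.

hamming-refl : (x : BitString n) → hamming x x ≡ 0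
hamming-refl []          = refl
hamming-refl (true  ∷ x) = hamming-refl x
hamming-refl (false ∷ x) = hamming-refl x

hamming-sym : (x y : BitString n) → hamming x y ≡ hamming y x
hamming-sym x y = cong (countᵇ id) (zipWith-comm xor-comm x y)

-- With the appended bits in front, their contribution to the distance is found by mere reduction
-- once they are known.
hamming-∷ʳ : ∀ a b (x y : BitString n) →
             hamming (x ∷ʳ a) (y ∷ʳ b) ≡ hamming (a ∷ x) (b ∷ y)
hamming-∷ʳ a b []      []      = refl
hamming-∷ʳ a b (c ∷ x) (d ∷ y)
  with ih ← hamming-∷ʳ a b x y | c xor d | a xor b
... | true  | true  = cong suc ih
... | true  | false = cong suc ih
... | false | true  = ih
... | false | false = ih

hamming-∷ʳ-same : ∀ b (x y : BitString n) → hamming (x ∷ʳ b) (y ∷ʳ b) ≡ hamming x y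
hamming-∷ʳ-same true  = hamming-∷ʳ true true
hamming-∷ʳ-same false = hamming-∷ʳ false false

differ-sym : ∀ {k} → Symmetric (DifferInAtMost {n} k)
differ-sym {x = x} {y} = subst (_≤ _) (hamming-sym x y)

hamming-flip : {x y : BitString n} → FlipFirst x y → hamming x y ≡ 1
hamming-flip (here {x = x}) = cong suc (hamming-refl x)
hamming-flip (there f)      = hamming-flip f

-- The strings z and e under flip and swap.

zeros-∷ʳ : ∀ n → zeros n ∷ʳ false ≡ zeros (suc n)
zeros-∷ʳ zero    = refl
zeros-∷ʳ (suc n) = cong (false ∷_) (zeros-∷ʳ n)

lastOne : ∀ n → BitString (suc n)
lastOne n = zeros n ∷ʳ true

flip-lastOne : ∀ n → FlipFirst (lastOne n) (zeros (suc n))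
flip-lastOne zero    = here
flip-lastOne (suc n) = there (flip-lastOne n)

-- If e lies in the half with last bit 0, this puts z followed by 1 in the language, so the other
-- half is not empty.
swap-lastOne : ∀ n → SwapFirst (lastOne n ∷ʳ false) (lastOne (suc n))
swap-lastOne zero    = here
swap-lastOne (suc n) = there (swap-lastOne n)

flip-∷ʳ : ∀ {b} {x y : BitString n} → FlipFirst x y → FlipFirst (x ∷ʳ b) (y ∷ʳ b)
flip-∷ʳ here      = here
flip-∷ʳ (there f) = there (flip-∷ʳ f)

swap-∷ʳ : ∀ {b} {x y : BitString n} → SwapFirst x y → SwapFirst (x ∷ʳ b) (y ∷ʳ b)
swap-∷ʳ here      = here
swap-∷ʳ (there s) = there (swap-∷ʳ s)

-- Unlike for a FlipSwapLanguage, 0⋯0 is not adjoined: S is empty or contains it.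
record Closed (S : Pred (BitString n) ℓ) : Set ℓ where
  field
    flip-closed : ∀ {x y} → S x → FlipFirst x y → S y
    swap-closed : ∀ {x y} → S x → SwapFirst x y → S y

open Closed

closed-∷ʳ : {S : Pred (BitString (suc n)) ℓ} → Closed S → ∀ b → Closed (S ∘ (_∷ʳ b))
closed-∷ʳ cl b .flip-closed s f = flip-closed cl s (flip-∷ʳ f)
closed-∷ʳ cl b .swap-closed s f = swap-closed cl s (swap-∷ʳ f)

-- xs stands for the listing of S in an order with first element z and last
-- element e; S e implies S z.
data Ends {A : Set a} (S : Pred A ℓ) (z e : A) : Pred (List A) (a Level.⊔ ℓ) where
  empty   : ¬ S z → Ends S z e []
  single  : S z → ¬ S e → Ends S z e [ z ]
  between : S z → S e → ∀ xs → Ends S z e (z ∷ xs ∷ʳᴸ e)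

-- The ends of a listing and of its two halves.

module _ {S : Pred A ℓ} {z e : A} where

  ends-∅ : ∀ {xs} → ¬ S z → Ends S z e xs → xs ≡ []
  ends-∅ ¬z (empty _)       = refl
  ends-∅ ¬z (single z _)    = contradiction z ¬z
  ends-∅ ¬z (between z _ _) = contradiction z ¬z

  ends-head : ∀ {xs} → S z → Ends S z e xs → ∃[ ys ] xs ≡ z ∷ ys
  ends-head z (empty ¬z)       = contradiction z ¬z
  ends-head z (single _ _)     = _ , refl
  ends-head z (between _ _ xs) = _ , refl

  ends-singleton : ∀ {xs} → S z → ¬ S e → Ends S z e xs → xs ≡ [ z ]
  ends-singleton z ¬e (empty ¬z)      = contradiction z ¬z
  ends-singleton z ¬e (single _ _)    = refl
  ends-singleton z ¬e (between _ e _) = contradiction e ¬e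

  -- Only three values of `last` are possible. `T` is left general to serve both the junction of the
  -- halves and cyclicity.
  ends-last : (T : Pred (Maybe A) ℓ₁) → T nothing → T (just z) → T (just e) →
              ∀ {xs} → Ends S z e xs → T (last xs)
  ends-last T t∅ tz te (empty _)        = t∅
  ends-last T t∅ tz te (single _ _)     = tz
  ends-last T t∅ tz te (between _ _ xs) = subst T (sym (last-∷ʳ (z ∷ xs) e)) te

-- The second half is reversed, so its first string `g z` comes last in the whole. The two
-- implications are instances of flip and swap. If `g z` is present, so is `f z`, and these are the
-- two ends.
ends-++ : {S : Pred B ℓ} (S? : Decidable S) {z e : A} (f g : A → B) →
  (S (g z) → S (f z)) → (S (f e) → S (g z)) →
  ∀ {xs ys} → Ends (S ∘ f) z e xs → Ends (S ∘ g) z e ys →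
  Ends S (f z) (g z) (map f xs ++ map g (reverse ys))
ends-++ {S = S} S? {z} {e} f g gz⇒fz fe⇒gz xs ys with S? (g z)
... | yes gz with ends-head (gz⇒fz gz) xs | ends-head gz ys
...   | us , refl | vs , refl =
  subst (Ends S (f z) (g z)) (sym eq) (between (gz⇒fz gz) gz (map f us ++ map g (reverse vs)))
  where
  open ≡-Reasoning
  eq : map f (z ∷ us) ++ map g (reverse (z ∷ vs)) ≡
       f z ∷ (map f us ++ map g (reverse vs)) ∷ʳᴸ g z
  eq = cong (f z ∷_) (begin
    map f us ++ map g (reverse (z ∷ vs))        ≡⟨ cong (λ ws → map f us ++ map g ws) (unfold-reverse z vs) ⟩
    map f us ++ map g (reverse vs ∷ʳᴸ z)        ≡⟨ cong (map f us ++_) (map-++ g (reverse vs) [ z ]) ⟩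
    map f us ++ (map g (reverse vs) ∷ʳᴸ g z)    ≡⟨ ++-assoc (map f us) _ _ ⟨
    (map f us ++ map g (reverse vs)) ∷ʳᴸ g z    ∎)
-- Without `g z` the second half is empty, and `fe⇒gz` keeps `e` out of the first, which leaves at
-- most `f z`.
ends-++ S? {z} f g gz⇒fz fe⇒gz xs ys | no ¬gz with refl ← ends-∅ ¬gz ys | S? (f z)
... | no ¬fz with refl ← ends-∅ ¬fz xs                           = empty ¬fz
... | yes fz with refl ← ends-singleton fz (¬gz ∘ fe⇒gz) xs      = single fz ¬gz

near-ends : ∀ {S T : Pred (BitString (suc n)) ℓ} {xs ys} →
  Ends S (zeros (suc n)) (lastOne n) xs → Ends T (zeros (suc n)) (lastOne n) ys →
  Connected (DifferInAtMost 1) (last xs) (last ys)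
near-ends {n = n} {ys = ys} xs-ends ys-ends =
  ends-last (λ m → Connected (DifferInAtMost 1) m (last ys))
    (ends-last (Connected _ nothing) nothing nothing-just nothing-just ys-ends)
    (ends-last (Connected _ (just z)) just-nothing (just (same z)) (just (differ-sym {x = e} e~z)) ys-ends)
    (ends-last (Connected _ (just e)) just-nothing (just e~z) (just (same e)) ys-ends)
    xs-ends
  where
  z = zeros (suc n)
  e = lastOne n
  same : ∀ x → DifferInAtMost 1 x x
  same x = subst (_≤ 1) (sym (hamming-refl x)) z≤n
  e~z : DifferInAtMost 1 e z
  e~z = ≤-reflexive (hamming-flip (flip-lastOne n))

-- Reversal brings the last string of `ys` to the junction. There the appended bits differ, which
-- raises the bound from 1 to 2; elsewhere they agree and cost nothing.
linked-halves : {xs ys : List (BitString n)} →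
  2-GrayCode xs → 2-GrayCode ys → Connected (DifferInAtMost 1) (last xs) (last ys) →
  2-GrayCode (map (_∷ʳ false) xs ++ map (_∷ʳ true) (reverse ys))
linked-halves {n = n} {xs} {ys} Rxs Rys c =
  Linked.++⁺ (half false Rxs) (subst₂ (Connected _) (sym (last-map _ xs)) eq (join c))
    (half true (linked-reverse (λ {x} → differ-sym {x = x}) Rys))
  where
  half : ∀ b {zs : List (BitString n)} → 2-GrayCode zs → 2-GrayCode (map (_∷ʳ b) zs)
  half b = Linked.map⁺ ∘ Linked.map (λ {x} {y} → subst (_≤ 2) (sym (hamming-∷ʳ-same b x y)))
  join : ∀ {u v : Maybe (BitString n)} → Connected (DifferInAtMost 1) u v →
         Connected (DifferInAtMost 2) (Maybe.map (_∷ʳ false) u) (Maybe.map (_∷ʳ true) v)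
  join (just {x} {y} d) = just (subst (_≤ 2) (sym (hamming-∷ʳ false true x y)) (s≤s d))
  join just-nothing     = just-nothing
  join nothing-just     = nothing-just
  join nothing          = nothing
  eq : Maybe.map (_∷ʳ true) (last ys) ≡ head (map (_∷ʳ true) (reverse ys))
  eq = sym (trans (head-map _ (reverse ys)) (cong (Maybe.map _) (head-reverse ys)))

-- Induction along the recursion of the BRGC.

inBRGCOrder-suc : {S : Pred (BitString (suc (suc n))) ℓ} (S? : Decidable S) →
  inBRGCOrder S? ≡ map (_∷ʳ false) (inBRGCOrder (S? ∘ (_∷ʳ false))) ++
                   map (_∷ʳ true) (reverse (inBRGCOrder (S? ∘ (_∷ʳ true))))
inBRGCOrder-suc {n = n} S? = begin
  filter S? (map f L ++ map g (reverse L))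
    ≡⟨ filter-++ S? (map f L) _ ⟩
  filter S? (map f L) ++ filter S? (map g (reverse L))
    ≡⟨ cong₂ _++_ (filter-map S? f L) (filter-map S? g (reverse L)) ⟩
  map f (filter (S? ∘ f) L) ++ map g (filter (S? ∘ g) (reverse L))
    ≡⟨ cong (λ ws → map f (filter (S? ∘ f) L) ++ map g ws) (filter-reverseAcc (S? ∘ g) [] L) ⟩
  map f (filter (S? ∘ f) L) ++ map g (reverse (filter (S? ∘ g) L)) ∎
  where
  open ≡-Reasoning
  f = _∷ʳ false
  g = _∷ʳ true
  L = BRGC (suc n)

closed-listing : ∀ n {S : Pred (BitString (suc n)) ℓ} (S? : Decidable S) → Closed S →
  2-GrayCode (inBRGCOrder S?) × Ends S (zeros (suc n)) (lastOne n) (inBRGCOrder S?)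
closed-listing zero S? cl with S? (false ∷ [])
closed-listing zero S? cl | yes z with S? (true ∷ [])
... | yes e = s≤s z≤n ∷ [-] , between z e []
... | no ¬e = [-] , single z ¬e
closed-listing zero S? cl | no ¬z with S? (true ∷ [])
... | yes e = contradiction (flip-closed cl e here) ¬z
... | no _  = [] , empty ¬z
closed-listing (suc n) {S} S? cl
  with gray₀ , ends₀ ← closed-listing n (S? ∘ (_∷ʳ false)) (closed-∷ʳ cl false)
  |    gray₁ , ends₁ ← closed-listing n (S? ∘ (_∷ʳ true)) (closed-∷ʳ cl true) =
    subst 2-GrayCode (sym (inBRGCOrder-suc S?))
      (linked-halves gray₀ gray₁ (near-ends ends₀ ends₁)) ,
    subst₂ (λ z xs → Ends S z (lastOne (suc n)) xs)
      (zeros-∷ʳ (suc n)) (sym (inBRGCOrder-suc S?))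
      (ends-++ S? (_∷ʳ false) (_∷ʳ true)
        -- By definition, z followed by 1 is `lastOne (suc n)`: it flips to 0⋯0, and it arises from
        -- e followed by 0 by a swap.
        (λ s → subst S (sym (zeros-∷ʳ (suc n))) (flip-closed cl s (flip-lastOne (suc n))))
        (λ s → swap-closed cl s (swap-lastOne n))
        ends₀ ends₁)

-- Adjoining the zero string, and cyclicity.

BRGC-zeros∷ : ∀ n → ∃[ xs ] BRGC (suc n) ≡ zeros (suc n) ∷ xs × All (_≢ zeros (suc n)) xs
BRGC-zeros∷ zero = _ , refl , (λ ()) ∷ []
BRGC-zeros∷ (suc n) with xs , eq , xs≢0 ← BRGC-zeros∷ n =
  map (_∷ʳ false) xs ++ ys ,
  trans (cong (λ L → map (_∷ʳ false) L ++ ys) eq)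
        (cong (_∷ map (_∷ʳ false) xs ++ ys) (zeros-∷ʳ (suc n))) ,
  -- Strings of the first half are nonzero before the 0 is appended; those of the second half end in
  -- 1.
  All.++⁺ (All.map⁺ (All.map (λ x≢0 x0≡0 → x≢0 (∷ʳ-injectiveˡ _ (zeros (suc n)) (last-0 x0≡0))) xs≢0))
          (All.map⁺ (All.universal (λ x x1≡0 → true≢false (∷ʳ-injectiveʳ x (zeros (suc n)) (last-0 x1≡0))) _))
  where
  ys = map (_∷ʳ true) (reverse (BRGC (suc n)))
  last-0 : ∀ {x} → x ≡ zeros (suc (suc n)) → x ≡ zeros (suc n) ∷ʳ false
  last-0 x≡0 = trans x≡0 (sym (zeros-∷ʳ (suc n)))
  true≢false : true ≢ false
  true≢false ()

module _ {S : Pred (BitString n) ℓ} (FS : FlipSwapLanguage S) where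

  open FlipSwapLanguage FS using () renaming (flip-closed to flip-∪; swap-closed to swap-∪)

  closed-∪zeros : Closed (S ∪ ｛ zeros n ｝)
  closed-∪zeros .flip-closed = flip-∪
  closed-∪zeros .swap-closed = swap-∪

  closed-zeros∈ : zeros n ∈ S → Closed S
  closed-zeros∈ z = λ where
      .flip-closed s f → absorb (flip-∪ (inj₁ s) f)
      .swap-closed s w → absorb (swap-∪ (inj₁ s) w)
    where
    absorb : ∀ {x} → x ∈ S ∪ ｛ zeros n ｝ → x ∈ S
    absorb (inj₁ s)    = s
    absorb (inj₂ refl) = z

filter-zeros∉ : {S : Pred (BitString (suc n)) ℓ} (S? : Decidable S)
  (S∪0? : Decidable (S ∪ ｛ zeros (suc n) ｝)) → ¬ zeros (suc n) ∈ S →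
  inBRGCOrder S∪0? ≡ zeros (suc n) ∷ inBRGCOrder S?
filter-zeros∉ {n = n} {S = S} S? S∪0? ¬z with xs , eq , xs≢0 ← BRGC-zeros∷ n = begin
  filter S∪0? (BRGC (suc n))           ≡⟨ cong (filter S∪0?) eq ⟩
  filter S∪0? (zeros (suc n) ∷ xs)     ≡⟨ filter-accept S∪0? (inj₂ refl) ⟩
  zeros (suc n) ∷ filter S∪0? xs       ≡⟨ cong (_ ∷_) (filter-agree S∪0? S? (All.map agree xs≢0)) ⟩
  zeros (suc n) ∷ filter S? xs         ≡⟨ cong (_ ∷_) (filter-reject S? ¬z) ⟨
  zeros (suc n) ∷ filter S? (zeros (suc n) ∷ xs)  ≡⟨ cong (λ L → zeros (suc n) ∷ filter S? L) eq ⟨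
  zeros (suc n) ∷ filter S? (BRGC (suc n)) ∎
  where
  open ≡-Reasoning
  agree : ∀ {x} → x ≢ zeros (suc n) →
          (x ∈ S ∪ ｛ zeros (suc n) ｝ → x ∈ S) × (x ∈ S → x ∈ S ∪ ｛ zeros (suc n) ｝)
  agree x≢0 = [ id , (λ 0≡x → contradiction (sym 0≡x) x≢0) ]′ , inj₁

ends-cyclic : {S : Pred (BitString (suc n)) ℓ} {xs : List (BitString (suc n))} →
  S (zeros (suc n)) → Ends S (zeros (suc n)) (lastOne n) xs → Cyclic xs
-- Matching on `ends-head` fixes the first string as 0⋯0; the last one is then at distance 0 or 1
-- from it.
ends-cyclic {n = n} z ends with _ , refl ← ends-head z ends =
  ends-last (λ m → Connected (DifferInAtMost 2) m (just (zeros (suc n))))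
    nothing-just
    (just (subst (_≤ 2) (sym (hamming-refl (zeros (suc n)))) z≤n))
    (just (m≤n⇒m≤1+n (≤-reflexive (hamming-flip (flip-lastOne n)))))
    ends

theorem2 : ∀ {ℓ : Level} (n : ℕ) .{{_ : NonZero n}}
    (S : Pred (BitString n) ℓ) (S? : Decidable S) →
    FlipSwapLanguage S →
    2-GrayCode (inBRGCOrder S?) ×
    (zeros n ∈ S → Cyclic (inBRGCOrder S?))
theorem2 (suc n) S S? FS with S? (zeros (suc n))
... | yes z = let gray , ends = closed-listing n S? (closed-zeros∈ FS z) in
              gray , λ _ → ends-cyclic z ends
-- The listing with 0⋯0 adjoined is a Gray code whose tail is the listing of `S`.
... | no ¬z = Linked.tail (subst 2-GrayCode (filter-zeros∉ S? S∪0? ¬z)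
                (proj₁ (closed-listing n S∪0? (closed-∪zeros FS)))) ,
              λ z → contradiction z ¬z
  where
  S∪0? : Decidable (S ∪ ｛ zeros (suc n) ｝)
  S∪0? = S? ∪? ≡-dec _≟ᵇ_ (zeros (suc n))
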